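{- Let $G$ be a dicot game and let $H$ be a binary game such that no follower of $H$ has misère outcome $\mathcal L$. Then $G \geqslant^-_{\mathcal{D}} H$ if and only if $G \geqslant^-_{\mathcal{DB}} H$.
   Context: A game is a finite two-player combinatorial game, defined recursively by $G=\{G^{\mathbf L}\mid G^{\mathbf R}\}$, where $G^{\mathbf L}$ and $G^{\mathbf R}$ are the finite sets of Left options and Right options, which are themselves games. The game $0=\{\cdot\mid\cdot\}$ has no options. A follower of $G$ is a game reachable from $G$ by a (possibly empty) succession of not necessarily alternating Left and Right moves; in particular $G$ is a follower of itself. The sum is $G+H=\{G^{\mathbf L}+H,\,G+H^{\mathbf L}\mid G^{\mathbf R}+H,\,G+H^{\mathbf R}\}$. Left and Right alternate moves. Under misère play, a player who cannot move on their turn wins. The misère outcome $o^-(G)$ is $\mathcal L$ (Left wins whoever starts), $\mathcal R$ (Right wins whoever starts), $\mathcal N$ (the first player wins) or $\mathcal P$ (the second player wins). Outcomes are partially ordered by $\mathcal R<\mathcal N<\mathcal L$ and $\mathcal R<\mathcal P<\mathcal L$, with $\mathcal N$ and $\mathcal P$ incomparable. For a set $\mathcal U$ of games and games $G,H$ (not necessarily in $\mathcal U$), $G\geqslant^-_{\mathcal U}H$ means $o^-(G+X)\geqslant o^-(H+X)$ for every $X\in\mathcal U$. A game is dicot if it is $0$, or if it has both Left and Right options and all of them are dicot. A game is binary if it has at most one Left option and at most one Right option, and all these options, if any, are binary. $\mathcal D$ is the set of all dicot games and $\mathcal{DB}$ is the set of all games that are both binary and dicot. -}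

module Defs where

open import Data.Fin.Base using (Fin; zero; suc)
open import Data.Nat.Base using (ℕ; zero; suc; NonZero)
open import Data.Product.Base using (_×_; _,_; ∃)
open import Data.Sum.Base using (_⊎_; inj₁; inj₂; swap)
open import Data.Vec.Functional using (Vector; []; _++_)
open import Relation.Binary.Construct.Closure.ReflexiveTransitive using (Star)
open import Relation.Binary.PropositionalEquality.Core using (_≡_; refl)
open import Relation.Nullary.Negation.Core using (¬_)

infix  4 _≅_ _⟶_ _FollowerOf_ _≤ᵒ_ _≥⁻[_]_
infixl 6 _⊕_

-- The finite sets of options are given by finite families, in which
-- repetitions are allowed; _≅_ below is equality of the sets so represented.
data Game : Set where
  ⟨_∣_⟩ : ∀ {l r} → Vector Game l → Vector Game r → Game

𝟘 : Game
𝟘 = ⟨ [] ∣ [] ⟩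

-- Hereditary extensional equality: the same set of Left options and the
-- same set of Right options.
_≅_ : Game → Game → Set
⟨ gᴸ ∣ gᴿ ⟩ ≅ ⟨ hᴸ ∣ hᴿ ⟩ =
    (∀ i → ∃ λ j → gᴸ i ≅ hᴸ j) × (∀ j → ∃ λ i → gᴸ i ≅ hᴸ j)
  × (∀ i → ∃ λ j → gᴿ i ≅ hᴿ j) × (∀ j → ∃ λ i → gᴿ i ≅ hᴿ j)

_⊕_ : Game → Game → Game
G@(⟨ gᴸ ∣ gᴿ ⟩) ⊕ H@(⟨ hᴸ ∣ hᴿ ⟩) =
  ⟨ (λ i → gᴸ i ⊕ H) ++ (λ j → G ⊕ hᴸ j)
  ∣ (λ i → gᴿ i ⊕ H) ++ (λ j → G ⊕ hᴿ j) ⟩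

data Player : Set where
  left right : Player

opponent : Player → Player
opponent left  = right
opponent right = left

#options : Player → Game → ℕ
#options left  (⟨_∣_⟩ {l} {r} _ _) = l
#options right (⟨_∣_⟩ {l} {r} _ _) = r

option : ∀ p G → Vector Game (#options p G)
option left  ⟨ gᴸ ∣ gᴿ ⟩ = gᴸ
option right ⟨ gᴸ ∣ gᴿ ⟩ = gᴿ

data _⟶_ : Game → Game → Set where
  move : ∀ p {G} (i : Fin (#options p G)) → G ⟶ option p G i

_FollowerOf_ : Game → Game → Set
K FollowerOf G = Star _⟶_ G K

-- Misère play: p wins G when p, respectively p's opponent, is to move.
mutual
  data WinsFirst (p : Player) (G : Game) : Set where
    cannotMove : #options p G ≡ 0 → WinsFirst p G
    moveTo     : ∀ i → WinsSecond p (option p G i) → WinsFirst p G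

  data WinsSecond (p : Player) (G : Game) : Set where
    reply : NonZero (#options (opponent p) G) →
            (∀ i → WinsFirst p (option (opponent p) G i)) →
            WinsSecond p G

search : ∀ {n} {A B : Fin n → Set} →
         (∀ i → A i ⊎ B i) → ∃ A ⊎ (∀ i → B i)
search {zero}  f = inj₂ λ ()
search {suc n} f with f zero | search (λ i → f (suc i))
... | inj₁ a | _            = inj₁ (zero , a)
... | inj₂ _ | inj₁ (i , a) = inj₁ (suc i , a)
... | inj₂ b | inj₂ bs      = inj₂ λ { zero → b ; (suc i) → bs i }

determined : ∀ p G → WinsFirst p G ⊎ WinsSecond (opponent p) G
determined left (⟨_∣_⟩ {zero} gᴸ gᴿ) = inj₁ (cannotMove refl)
determined left (⟨_∣_⟩ {suc l} gᴸ gᴿ)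
  with search (λ i → swap (determined right (gᴸ i)))
... | inj₁ (i , w) = inj₁ (moveTo i w)
... | inj₂ ws      = inj₂ (reply _ ws)
determined right (⟨_∣_⟩ {_} {zero} gᴸ gᴿ) = inj₁ (cannotMove refl)
determined right (⟨_∣_⟩ {_} {suc r} gᴸ gᴿ)
  with search (λ i → swap (determined left (gᴿ i)))
... | inj₁ (i , w) = inj₁ (moveTo i w)
... | inj₂ ws      = inj₂ (reply _ ws)

exclusive : ∀ p G → WinsFirst p G → ¬ WinsSecond (opponent p) G
exclusive left  ⟨ gᴸ ∣ gᴿ ⟩ (cannotMove refl) (reply () _)
exclusive left  ⟨ gᴸ ∣ gᴿ ⟩ (moveTo i w)      (reply _ ws) =
  exclusive right (gᴸ i) (ws i) w
exclusive right ⟨ gᴸ ∣ gᴿ ⟩ (cannotMove refl) (reply () _)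
exclusive right ⟨ gᴸ ∣ gᴿ ⟩ (moveTo i w)      (reply _ ws) =
  exclusive left (gᴿ i) (ws i) w

data Outcome : Set where
  𝓛 𝓡 𝓝 𝓟 : Outcome

-- The first argument says who wins when Left starts, the second who wins
-- when Right starts; by `exclusive` the alternatives in each are disjoint.
outcome : ∀ {G} → WinsFirst left  G ⊎ WinsSecond right G →
                  WinsFirst right G ⊎ WinsSecond left  G → Outcome
outcome (inj₁ _) (inj₂ _) = 𝓛
outcome (inj₂ _) (inj₁ _) = 𝓡
outcome (inj₁ _) (inj₁ _) = 𝓝
outcome (inj₂ _) (inj₂ _) = 𝓟

o⁻ : Game → Outcome
o⁻ G = outcome (determined left G) (determined right G)

data _≤ᵒ_ : Outcome → Outcome → Set where
  ≤ᵒ-refl : ∀ {a} → a ≤ᵒ a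
  𝓡-min   : ∀ {a} → 𝓡 ≤ᵒ a
  𝓛-max   : ∀ {a} → a ≤ᵒ 𝓛

_≥⁻[_]_ : Game → (Game → Set) → Game → Set
G ≥⁻[ 𝓤 ] H = ∀ X → 𝓤 X → o⁻ (H ⊕ X) ≤ᵒ o⁻ (G ⊕ X)

data Dicot : Game → Set where
  zero    : ∀ {G} → G ≅ 𝟘 → Dicot G
  nonzero : ∀ {l r} {gᴸ : Vector Game (suc l)} {gᴿ : Vector Game (suc r)} →
            (∀ i → Dicot (gᴸ i)) → (∀ j → Dicot (gᴿ j)) →
            Dicot ⟨ gᴸ ∣ gᴿ ⟩

-- "At most one option" counts options as elements of a set, hence up to _≅_.
data Binary : Game → Set where
  binary : ∀ {l r} {gᴸ : Vector Game l} {gᴿ : Vector Game r} →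
           (∀ i i′ → gᴸ i ≅ gᴸ i′) → (∀ j j′ → gᴿ j ≅ gᴿ j′) →
           (∀ i → Binary (gᴸ i)) → (∀ j → Binary (gᴿ j)) →
           Binary ⟨ gᴸ ∣ gᴿ ⟩

𝓓 : Game → Set
𝓓 G = Dicot G

𝓓𝓑 : Game → Set
𝓓𝓑 G = Binary G × Dicot G

{-# OPTIONS --safe #-}

-- The comparison of G and H modulo 𝓓 is decided recursively: G ≽ H as soon
-- as the outcomes of G and H are in order, every Gᴿ has some Gᴿᴸ ≽ H or
-- some Hᴿ ≼ Gᴿ, and every Hᴸ has some Gᴸ ≽ Hᴸ or some Hᴸᴿ ≼ G.
-- Otherwise G ⋡ H, an inductive relation.  The usual separating game has one
-- Right option for each Kᴸ of a downlinked K ⇓ H, hence is not binary.  Here,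
-- by recursion on H, a single Z ∈ 𝓓𝓑 is built such that Left wins H + Z
-- playing first while Right wins G + Z playing second for all dicot G of
-- height at most n with G ⋡ H at once, so one Right option answers every Kᴸ.
-- This needs every failure of the outcome condition to reduce to a failure
-- that Z = 𝟘 exposes with Left to move, which holds as no follower of H has
-- outcome 𝓛.

module Submission where

open import Defs
open import Data.Empty using (⊥-elim)
open import Data.Fin.Base using (Fin; zero; suc; splitAt; _↑ˡ_; _↑ʳ_)
open import Data.Nat.Base using (ℕ; zero; suc; NonZero; _+_; _⊔_; _≤_; s≤s)
open import Data.Nat.Properties using (m≤m⊔n; m≤n⊔m; m+n≡0⇒m≡0; m+n≡0⇒n≡0)
open import Data.Product.Base using (_×_; _,_; ∃; proj₁; proj₂)
open import Data.Sum.Base using (_⊎_; inj₁; inj₂; swap)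
open import Data.Vec.Functional using (Vector)
open import Data.Vec.Functional.Properties using (lookup-++ˡ; lookup-++ʳ)
open import Function.Bundles using (_⇔_; mk⇔)
open import Relation.Binary.Construct.Closure.ReflexiveTransitive using (ε; _◅_)
open import Relation.Binary.PropositionalEquality using (_≡_; _≢_; refl; sym; trans; cong₂; subst)
open import Relation.Nullary.Negation.Core using (¬_)

-- Induction on games and finite index types

game-induction : (P : Game → Set) →
  (∀ G → (∀ p i → P (option p G i)) → P G) → ∀ G → P G
game-induction P step G@(⟨ gᴸ ∣ gᴿ ⟩) = step G λ where
  left  i → game-induction P step (gᴸ i)
  right i → game-induction P step (gᴿ i)

noOption : ∀ {n} {A : Set} → n ≡ 0 → Fin n → A
noOption refl ()

empty⇒≡0 : ∀ {n} → ¬ Fin n → n ≡ 0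
empty⇒≡0 {zero}  _  = refl
empty⇒≡0 {suc n} ¬i = ⊥-elim (¬i zero)

nonZero : ∀ {n} → Fin n → NonZero n
nonZero zero    = _
nonZero (suc _) = _

someOption : ∀ {n} → NonZero n → Fin n
someOption {suc n} _ = zero

-- Equality of games

≅-intro : ∀ G H →
  (∀ p i → ∃ λ j → option p G i ≅ option p H j) →
  (∀ p j → ∃ λ i → option p G i ≅ option p H j) → G ≅ H
≅-intro ⟨ _ ∣ _ ⟩ ⟨ _ ∣ _ ⟩ f g = f left , g left , f right , g right

≅-forth : ∀ G H → G ≅ H → ∀ p i → ∃ λ j → option p G i ≅ option p H j
≅-forth ⟨ _ ∣ _ ⟩ ⟨ _ ∣ _ ⟩ (a , _ , _ , _) left  = a
≅-forth ⟨ _ ∣ _ ⟩ ⟨ _ ∣ _ ⟩ (_ , _ , c , _) right = c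

≅-back : ∀ G H → G ≅ H → ∀ p j → ∃ λ i → option p G i ≅ option p H j
≅-back ⟨ _ ∣ _ ⟩ ⟨ _ ∣ _ ⟩ (_ , b , _ , _) left  = b
≅-back ⟨ _ ∣ _ ⟩ ⟨ _ ∣ _ ⟩ (_ , _ , _ , d) right = d

≅-refl : ∀ G → G ≅ G
≅-refl = game-induction (λ G → G ≅ G) λ G ih →
  ≅-intro G G (λ p i → i , ih p i) (λ p i → i , ih p i)

≅-noOptions : ∀ G H → G ≅ H → ∀ p → #options p G ≡ 0 → #options p H ≡ 0
≅-noOptions G H e p z = empty⇒≡0 λ j → noOption z (proj₁ (≅-back G H e p j))

≅𝟘⇒noOptions : ∀ {G} → G ≅ 𝟘 → ∀ p → #options p G ≡ 0
≅𝟘⇒noOptions {G} e left  = empty⇒≡0 λ i → noOption {0} refl (proj₁ (≅-forth G 𝟘 e left i))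
≅𝟘⇒noOptions {G} e right = empty⇒≡0 λ i → noOption {0} refl (proj₁ (≅-forth G 𝟘 e right i))

≅-sym : ∀ G H → G ≅ H → H ≅ G
≅-sym = game-induction (λ G → ∀ H → G ≅ H → H ≅ G) λ G ih H e →
  ≅-intro H G
    (λ p j → let i , e′ = ≅-back G H e p j in i , ih p i (option p H j) e′)
    (λ p i → let j , e′ = ≅-forth G H e p i in j , ih p i (option p H j) e′)

mutual
  winsFirst-resp : ∀ {p} G H → G ≅ H → WinsFirst p G → WinsFirst p H
  winsFirst-resp {p} G H e (cannotMove z) = cannotMove (≅-noOptions G H e p z)
  winsFirst-resp {p} G H e (moveTo i w) =
    let j , e′ = ≅-forth G H e p i
    in moveTo j (winsSecond-resp (option p G i) (option p H j) e′ w)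

  winsSecond-resp : ∀ {p} G H → G ≅ H → WinsSecond p G → WinsSecond p H
  winsSecond-resp {p} G H e (reply nz ws) =
    reply (nonZero (proj₁ (≅-forth G H e (opponent p) (someOption nz)))) λ j →
      let i , e′ = ≅-back G H e (opponent p) j
      in winsFirst-resp (option (opponent p) G i) (option (opponent p) H j) e′ (ws i)

-- Sums

#options-⊕ : ∀ p G X → #options p (G ⊕ X) ≡ #options p G + #options p X
#options-⊕ left  ⟨ _ ∣ _ ⟩ ⟨ _ ∣ _ ⟩ = refl
#options-⊕ right ⟨ _ ∣ _ ⟩ ⟨ _ ∣ _ ⟩ = refl

option-⊕ˡ : ∀ p G X i → ∃ λ k → option p (G ⊕ X) k ≡ option p G i ⊕ X
option-⊕ˡ left  G@(⟨ gᴸ ∣ _ ⟩) X@(⟨ xᴸ ∣ _ ⟩) i =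
  i ↑ˡ _ , lookup-++ˡ (λ i → gᴸ i ⊕ X) (λ j → G ⊕ xᴸ j) i
option-⊕ˡ right G@(⟨ _ ∣ gᴿ ⟩) X@(⟨ _ ∣ xᴿ ⟩) i =
  i ↑ˡ _ , lookup-++ˡ (λ i → gᴿ i ⊕ X) (λ j → G ⊕ xᴿ j) i

option-⊕ʳ : ∀ p G X j → ∃ λ k → option p (G ⊕ X) k ≡ G ⊕ option p X j
option-⊕ʳ left  G@(⟨ gᴸ ∣ _ ⟩) X@(⟨ xᴸ ∣ _ ⟩) j =
  _ ↑ʳ j , lookup-++ʳ (λ i → gᴸ i ⊕ X) (λ j → G ⊕ xᴸ j) j
option-⊕ʳ right G@(⟨ _ ∣ gᴿ ⟩) X@(⟨ _ ∣ xᴿ ⟩) j =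
  _ ↑ʳ j , lookup-++ʳ (λ i → gᴿ i ⊕ X) (λ j → G ⊕ xᴿ j) j

data SumOption (p : Player) (G X : Game) : Game → Set where
  inˡ : ∀ i → SumOption p G X (option p G i ⊕ X)
  inʳ : ∀ j → SumOption p G X (G ⊕ option p X j)

sumOption : ∀ p G X k → SumOption p G X (option p (G ⊕ X) k)
sumOption left  (⟨_∣_⟩ {l} _ _) ⟨ _ ∣ _ ⟩ k with splitAt l k
... | inj₁ i = inˡ i
... | inj₂ j = inʳ j
sumOption right (⟨_∣_⟩ {_} {r} _ _) ⟨ _ ∣ _ ⟩ k with splitAt r k
... | inj₁ i = inˡ i
... | inj₂ j = inʳ j

⊕-congˡ : ∀ G H X → G ≅ H → G ⊕ X ≅ H ⊕ X
⊕-congˡ = game-induction (λ G → ∀ H X → G ≅ H → G ⊕ X ≅ H ⊕ X) λ G ihG H →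
  game-induction (λ X → G ≅ H → G ⊕ X ≅ H ⊕ X) λ X ihX e →
  let forth : ∀ p {K} → SumOption p G X K → ∃ λ j → K ≅ option p (H ⊕ X) j
      forth p = λ where
        (inˡ i) → let j , e′ = ≅-forth G H e p i
                      k , eq = option-⊕ˡ p H X j
                  in k , subst (_ ≅_) (sym eq) (ihG p i (option p H j) X e′)
        (inʳ i) → let k , eq = option-⊕ʳ p H X i
                  in k , subst (_ ≅_) (sym eq) (ihX p i e)
      back : ∀ p {K} → SumOption p H X K → ∃ λ i → option p (G ⊕ X) i ≅ K
      back p = λ where
        (inˡ j) → let i , e′ = ≅-back G H e p j
                      k , eq = option-⊕ˡ p G X i
                  in k , subst (_≅ _) (sym eq) (ihG p i (option p H j) X e′)
        (inʳ j) → let k , eq = option-⊕ʳ p G X j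
                  in k , subst (_≅ _) (sym eq) (ihX p j e)
  in ≅-intro (G ⊕ X) (H ⊕ X)
       (λ p k → forth p (sumOption p G X k))
       (λ p k → back p (sumOption p H X k))

⊕-identityʳ : ∀ {X} → (∀ p → #options p X ≡ 0) → ∀ G → G ⊕ X ≅ G
⊕-identityʳ {X} z = game-induction (λ G → G ⊕ X ≅ G) λ G ih →
  let forth : ∀ p {K} → SumOption p G X K → ∃ λ j → K ≅ option p G j
      forth p = λ where
        (inˡ i) → i , ih p i
        (inʳ j) → noOption (z p) j
  in ≅-intro (G ⊕ X) G
       (λ p k → forth p (sumOption p G X k))
       (λ p i → let k , eq = option-⊕ˡ p G X i
                in k , subst (_≅ _) (sym eq) (ih p i))

cannotMove-⊕ : ∀ {p} G X → #options p G ≡ 0 → #options p X ≡ 0 → WinsFirst p (G ⊕ X)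
cannotMove-⊕ {p} G X g x = cannotMove (trans (#options-⊕ p G X) (cong₂ _+_ g x))

moveˡ : ∀ {p} G X i → WinsSecond p (option p G i ⊕ X) → WinsFirst p (G ⊕ X)
moveˡ {p} G X i w =
  let k , eq = option-⊕ˡ p G X i in moveTo k (subst (WinsSecond p) (sym eq) w)

moveʳ : ∀ {p} G X j → WinsSecond p (G ⊕ option p X j) → WinsFirst p (G ⊕ X)
moveʳ {p} G X j w =
  let k , eq = option-⊕ʳ p G X j in moveTo k (subst (WinsSecond p) (sym eq) w)

reply-⊕ : ∀ {p} G X → Fin (#options (opponent p) X) →
  (∀ i → WinsFirst p (option (opponent p) G i ⊕ X)) →
  (∀ j → WinsFirst p (G ⊕ option (opponent p) X j)) → WinsSecond p (G ⊕ X)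
reply-⊕ {p} G X j₀ f g =
  reply (nonZero (proj₁ (option-⊕ʳ (opponent p) G X j₀)))
        (λ k → answer (sumOption (opponent p) G X k))
  where
  answer : ∀ {K} → SumOption (opponent p) G X K → WinsFirst p K
  answer (inˡ i) = f i
  answer (inʳ j) = g j

data FirstMove (p : Player) (G X : Game) : Set where
  none : #options p G ≡ 0 → #options p X ≡ 0 → FirstMove p G X
  inˡ  : ∀ i → WinsSecond p (option p G i ⊕ X) → FirstMove p G X
  inʳ  : ∀ j → WinsSecond p (G ⊕ option p X j) → FirstMove p G X

firstMove : ∀ {p} G X → WinsFirst p (G ⊕ X) → FirstMove p G X
firstMove {p} G X (cannotMove z) = none (m+n≡0⇒m≡0 _ z′) (m+n≡0⇒n≡0 (#options p G) z′)
  where z′ = trans (sym (#options-⊕ p G X)) z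
firstMove {p} G X (moveTo k w) = split (sumOption p G X k) w
  where
  split : ∀ {K} → SumOption p G X K → WinsSecond p K → FirstMove p G X
  split (inˡ i) = inˡ i
  split (inʳ j) = inʳ j

replyˡ : ∀ {p} G X → WinsSecond p (G ⊕ X) →
  ∀ i → WinsFirst p (option (opponent p) G i ⊕ X)
replyˡ {p} G X (reply _ ws) i =
  let k , eq = option-⊕ˡ (opponent p) G X i in subst (WinsFirst p) eq (ws k)

replyʳ : ∀ {p} G X → WinsSecond p (G ⊕ X) →
  ∀ j → WinsFirst p (G ⊕ option (opponent p) X j)
replyʳ {p} G X (reply _ ws) j =
  let k , eq = option-⊕ʳ (opponent p) G X j in subst (WinsFirst p) eq (ws k)

-- Outcomes

-- The order on outcomes is componentwise: who wins when Left starts, and who wins when Right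
-- starts.
≤ᵒ-intro : ∀ A B → (WinsFirst left A → WinsFirst left B) →
  (WinsSecond left A → WinsSecond left B) → o⁻ A ≤ᵒ o⁻ B
≤ᵒ-intro A B f g
  with determined left A | determined right A | determined left B | determined right B
... | inj₁ _ | inj₁ _ | inj₁ _ | inj₁ _ = ≤ᵒ-refl
... | inj₁ _ | inj₁ _ | inj₁ _ | inj₂ _ = 𝓛-max
... | inj₁ a | inj₁ _ | inj₂ b | _      = ⊥-elim (exclusive left B (f a) b)
... | inj₁ _ | inj₂ _ | inj₁ _ | inj₂ _ = ≤ᵒ-refl
... | inj₁ a | inj₂ _ | inj₂ b | inj₂ _ = ⊥-elim (exclusive left B (f a) b)
... | inj₁ _ | inj₂ a | _      | inj₁ b = ⊥-elim (exclusive right B b (g a))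
... | inj₂ _ | inj₁ _ | _      | _      = 𝓡-min
... | inj₂ _ | inj₂ _ | inj₁ _ | inj₂ _ = 𝓛-max
... | inj₂ _ | inj₂ _ | inj₂ _ | inj₂ _ = ≤ᵒ-refl
... | inj₂ _ | inj₂ a | _      | inj₁ b = ⊥-elim (exclusive right B b (g a))

≤ᵒ⇒winsFirst : ∀ A B → o⁻ A ≤ᵒ o⁻ B → WinsFirst left A → WinsFirst left B
≤ᵒ⇒winsFirst A B le w
  with determined left A | determined right A | determined left B | determined right B
≤ᵒ⇒winsFirst A B le w | _      | _      | inj₁ b | _      = b
≤ᵒ⇒winsFirst A B le w | inj₂ a | _      | inj₂ _ | _      = ⊥-elim (exclusive left A w a)
≤ᵒ⇒winsFirst A B () w | inj₁ _ | inj₁ _ | inj₂ _ | inj₁ _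
≤ᵒ⇒winsFirst A B () w | inj₁ _ | inj₁ _ | inj₂ _ | inj₂ _
≤ᵒ⇒winsFirst A B () w | inj₁ _ | inj₂ _ | inj₂ _ | inj₁ _
≤ᵒ⇒winsFirst A B () w | inj₁ _ | inj₂ _ | inj₂ _ | inj₂ _

No𝓛 : Game → Set
No𝓛 H = ∀ K → K FollowerOf H → o⁻ K ≢ 𝓛

No𝓛-option : ∀ {H} → No𝓛 H → ∀ p i → No𝓛 (option p H i)
No𝓛-option n p i K K⊴ = n K (move p i ◅ K⊴)

No𝓛⇒¬both : ∀ {H} → No𝓛 H → WinsFirst left H → ¬ WinsSecond left H
No𝓛⇒¬both {H} n w v = n H ε o⁻≡𝓛
  where
  o⁻≡𝓛 : o⁻ H ≡ 𝓛
  o⁻≡𝓛 with determined left H | determined right H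
  ... | inj₁ _ | inj₂ _ = refl
  ... | inj₁ _ | inj₁ b = ⊥-elim (exclusive right H b v)
  ... | inj₂ a | _      = ⊥-elim (exclusive left H w a)

-- Dicot and binary games

dicot-option : ∀ {G} → Dicot G → ∀ p i → Dicot (option p G i)
dicot-option (zero e)      p     i = noOption (≅𝟘⇒noOptions e p) i
dicot-option (nonzero f g) left  i = f i
dicot-option (nonzero f g) right j = g j

dicot-noOptions : ∀ {G} → Dicot G → ∀ p → #options p G ≡ 0 → ∀ q → #options q G ≡ 0
dicot-noOptions (zero e) _ _ q = ≅𝟘⇒noOptions e q
dicot-noOptions (nonzero _ _) left  ()
dicot-noOptions (nonzero _ _) right ()

binary-option : ∀ {H} → Binary H → ∀ p i → Binary (option p H i)
binary-option (binary _ _ f g) left  i = f i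
binary-option (binary _ _ f g) right j = g j

binary-≅ : ∀ {H} → Binary H → ∀ p i j → option p H i ≅ option p H j
binary-≅ (binary f g _ _) left  = f
binary-≅ (binary f g _ _) right = g

infix 5 _∥_

_∥_ : Game → Game → Game
A ∥ B = ⟨ (λ (_ : Fin 1) → A) ∣ (λ (_ : Fin 1) → B) ⟩

𝟘-𝓓𝓑 : 𝓓𝓑 𝟘
𝟘-𝓓𝓑 = binary (λ ()) (λ ()) (λ ()) (λ ()) , zero (≅-refl 𝟘)

∥-𝓓𝓑 : ∀ {A B} → 𝓓𝓑 A → 𝓓𝓑 B → 𝓓𝓑 (A ∥ B)
∥-𝓓𝓑 {A} {B} (a , a′) (b , b′) =
  binary (λ _ _ → ≅-refl A) (λ _ _ → ≅-refl B) (λ _ → a) (λ _ → b) ,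
  nonzero (λ _ → a′) (λ _ → b′)

-- A bound on the height, so that one `rightWinning n` beats all the dicots considered at once.
data Dicot≤ : ℕ → Game → Set where
  zero    : ∀ {n G} → (∀ p → #options p G ≡ 0) → Dicot≤ n G
  nonzero : ∀ {n G} → (∀ p → Fin (#options p G)) →
            (∀ p i → Dicot≤ n (option p G i)) → Dicot≤ (suc n) G

Dicot≤-mono : ∀ {m n G} → m ≤ n → Dicot≤ m G → Dicot≤ n G
Dicot≤-mono _         (zero z)      = zero z
Dicot≤-mono (s≤s m≤n) (nonzero f g) = nonzero f λ p i → Dicot≤-mono m≤n (g p i)

Dicot≤-suc : ∀ {n G} → Dicot≤ n G → Dicot≤ (suc n) G
Dicot≤-suc (zero z)      = zero z
Dicot≤-suc (nonzero f g) = nonzero f λ p i → Dicot≤-suc (g p i)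

Dicot≤-option : ∀ {n G} → Dicot≤ n G → ∀ p i → Dicot≤ n (option p G i)
Dicot≤-option (zero z)      p i = noOption (z p) i
Dicot≤-option (nonzero f g) p i = Dicot≤-suc (g p i)

Dicot≤-option⁻ : ∀ {n G} → Dicot≤ (suc n) G → ∀ p i → Dicot≤ n (option p G i)
Dicot≤-option⁻ (zero z)      p i = noOption (z p) i
Dicot≤-option⁻ (nonzero f g) p i = g p i

upperBound : ∀ {k} {G : Vector Game k} →
  (∀ i → ∃ λ n → Dicot≤ n (G i)) → ∃ λ n → ∀ i → Dicot≤ n (G i)
upperBound {zero}  f = 0 , λ ()
upperBound {suc k} f =
  let m , b  = f zero
      n , bs = upperBound (λ i → f (suc i))
  in m ⊔ n , λ where
    zero    → Dicot≤-mono (m≤m⊔n m n) b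
    (suc i) → Dicot≤-mono (m≤n⊔m m n) (bs i)

dicot⇒Dicot≤ : ∀ {G} → Dicot G → ∃ λ n → Dicot≤ n G
dicot⇒Dicot≤ (zero e) = 0 , zero (≅𝟘⇒noOptions e)
dicot⇒Dicot≤ (nonzero f g) =
  let m , bs = upperBound (λ i → dicot⇒Dicot≤ (f i))
      n , cs = upperBound (λ j → dicot⇒Dicot≤ (g j))
  in suc (m ⊔ n) , nonzero (λ { left → zero ; right → zero }) λ where
    left  i → Dicot≤-mono (m≤m⊔n m n) (bs i)
    right j → Dicot≤-mono (m≤n⊔m m n) (cs j)

-- Games that beat every dicot of bounded height, or a given binary game

-- The base game has outcome `𝓡`: Left's move to `𝟘` leaves Right without a move, and Right's move
-- to `𝟘 ∥ 𝟘` forces Left to do the same. Each further level is a tempo move open to both players,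
-- spent against one unit of the height of the dicot.
rightWinning : ℕ → Game
rightWinning zero    = 𝟘 ∥ (𝟘 ∥ 𝟘)
rightWinning (suc n) = rightWinning n ∥ rightWinning n

rightWinning-𝓓𝓑 : ∀ n → 𝓓𝓑 (rightWinning n)
rightWinning-𝓓𝓑 zero    = ∥-𝓓𝓑 𝟘-𝓓𝓑 (∥-𝓓𝓑 𝟘-𝓓𝓑 𝟘-𝓓𝓑)
rightWinning-𝓓𝓑 (suc n) = ∥-𝓓𝓑 (rightWinning-𝓓𝓑 n) (rightWinning-𝓓𝓑 n)

-- Right steps down to rightWinning n once Left has moved in G, and moves in G
-- once Left has stepped down.
mutual
  rightWinning-second : ∀ n {G} → Dicot≤ n G → WinsSecond right (G ⊕ rightWinning n)
  rightWinning-second zero {G} (zero z) = reply-⊕ G _ zero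
    (λ i → noOption (z left) i)
    (λ { zero → cannotMove-⊕ G 𝟘 (z right) refl })
  rightWinning-second (suc n) {G} (zero z) = reply-⊕ G _ zero
    (λ i → noOption (z left) i)
    (λ { zero → rightWinning-first-zero n G z })
  rightWinning-second (suc n) {G} (nonzero f g) = reply-⊕ G _ zero
    (λ i → moveʳ (option left G i) (rightWinning (suc n)) zero (rightWinning-second n (g left i)))
    (λ { zero → moveˡ G (rightWinning n) (f right) (rightWinning-second n (g right (f right))) })

  rightWinning-first-zero : ∀ n G → (∀ p → #options p G ≡ 0) →
    WinsFirst right (G ⊕ rightWinning n)
  rightWinning-first-zero zero G z = moveʳ G (rightWinning 0) zero (reply-⊕ G _ zero
    (λ i → noOption (z left) i)
    (λ { zero → cannotMove-⊕ G 𝟘 (z right) refl }))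
  rightWinning-first-zero (suc n) G z =
    moveʳ G (rightWinning (suc n)) zero (rightWinning-second n (zero z))

rightWinning-first : ∀ n {G} → Dicot≤ n G → WinsFirst right (G ⊕ rightWinning (suc n))
rightWinning-first n {G} d = moveʳ G (rightWinning (suc n)) zero (rightWinning-second n d)

-- `Binary` identifies options only up to `≅`; this carries a test game built for the option with
-- index `zero` over to the others.
winsSecond-⊕-resp : ∀ {p G H} X → G ≅ H → WinsSecond p (G ⊕ X) → WinsSecond p (H ⊕ X)
winsSecond-⊕-resp {p} {G} {H} X e = winsSecond-resp (G ⊕ X) (H ⊕ X) (⊕-congˡ G H X e)

LeftWinning : Game → Set
LeftWinning H = ∃ λ A → 𝓓𝓑 A × WinsSecond left (H ⊕ A)

-- A = { A(Hᴿ) | A(Hᴸ) }, with 𝟘 in place of a missing option.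
leftWinning : ∀ {H} → Binary H → LeftWinning H
leftWinning {H} (binary {l} {r} {hᴸ} {hᴿ} _ eᴿ bᴸ bᴿ) =
  let C , C-𝓓𝓑 , C-wins = afterRight eᴿ (λ j → leftWinning (bᴿ j))
      D , D-𝓓𝓑 , D-wins = afterLeft (λ i → leftWinning (bᴸ i))
  in C ∥ D , ∥-𝓓𝓑 C-𝓓𝓑 D-𝓓𝓑 , reply-⊕ H (C ∥ D) zero
       (λ j → moveʳ (hᴿ j) (C ∥ D) zero (C-wins j))
       (λ _ → D-wins)
  where
  afterRight : ∀ {r} {hᴿ : Vector Game r} → (∀ i j → hᴿ i ≅ hᴿ j) →
    (∀ j → LeftWinning (hᴿ j)) → ∃ λ C → 𝓓𝓑 C × (∀ j → WinsSecond left (hᴿ j ⊕ C))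
  afterRight {zero}  _ _ = 𝟘 , 𝟘-𝓓𝓑 , λ ()
  afterRight {suc r} e f =
    let C , C-𝓓𝓑 , w = f zero in C , C-𝓓𝓑 , λ j → winsSecond-⊕-resp C (e zero j) w

  afterLeft : ∀ {l} {hᴸ : Vector Game l} → (∀ i → LeftWinning (hᴸ i)) →
    ∃ λ D → 𝓓𝓑 D × WinsFirst left (⟨ hᴸ ∣ hᴿ ⟩ ⊕ D)
  -- The default `𝟘` wins here: Left, on turn, has no move in either component.
  afterLeft {zero}  {hᴸ} _ = 𝟘 , 𝟘-𝓓𝓑 , cannotMove-⊕ ⟨ hᴸ ∣ hᴿ ⟩ 𝟘 refl refl
  afterLeft {suc l} {hᴸ} f =
    let D , D-𝓓𝓑 , w = f zero in D , D-𝓓𝓑 , moveˡ ⟨ hᴸ ∣ hᴿ ⟩ D zero w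

-- Failure of comparison

infix 4 _⋡_ _⇓_

mutual
  -- `K ⇓ H` is the recursive form of downlinking, the existence of a `T` such that Right wins
  -- `K ⊕ T` and Left wins `H ⊕ T`, each moving second. `end` is the failure that `𝟘` exposes with
  -- Left to move.
  data _⋡_ : Game → Game → Set where
    end     : ∀ {G H} → #options left H ≡ 0 → WinsSecond right G → G ⋡ H
    onRight : ∀ {G H} i → option right G i ⇓ H → G ⋡ H
    onLeft  : ∀ {G H} j → G ⇓ option left H j → G ⋡ H

  data _⇓_ : Game → Game → Set where
    downlink : ∀ {G H} → (∀ i → option left G i ⋡ H) → (∀ j → G ⋡ option right H j) → G ⇓ H

mutual
  ⋡-respʳ : ∀ {G} H H′ → H ≅ H′ → G ⋡ H → G ⋡ H′
  ⋡-respʳ H H′ e (end z w)     = end (≅-noOptions H H′ e left z) w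
  ⋡-respʳ H H′ e (onRight i d) = onRight i (⇓-respʳ H H′ e d)
  ⋡-respʳ H H′ e (onLeft j d)  =
    let k , e′ = ≅-forth H H′ e left j
    in onLeft k (⇓-respʳ (option left H j) (option left H′ k) e′ d)

  ⇓-respʳ : ∀ {G} H H′ → H ≅ H′ → G ⇓ H → G ⇓ H′
  ⇓-respʳ H H′ e (downlink f g) = downlink (λ i → ⋡-respʳ H H′ e (f i)) λ k →
    let j , e′ = ≅-back H H′ e right k
    in ⋡-respʳ (option right H j) (option right H′ k) e′ (g j)

-- Right wins J = Hᴸ moving first, so (J having at most one Right option) each
-- Jᴿ again satisfies the hypothesis on H.
noOptions⋡ : ∀ {G H} → (∀ p → #options p G ≡ 0) → Binary H → WinsSecond right H → G ⋡ H
noOptions⋡ {G} {H} z b (reply nz ws) = onLeft j₀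
  (downlink (λ i → noOption (z left) i) (λ k → step (ws j₀) k))
  where
  j₀ = someOption nz
  bᴶ = binary-option b left j₀
  step : WinsFirst right (option left H j₀) → ∀ k → G ⋡ option right (option left H j₀) k
  step (cannotMove y) k = noOption y k
  step (moveTo i w)   k = ⋡-respʳ _ _ (binary-≅ bᴶ right i k)
    (noOptions⋡ z (binary-option bᴶ right i) w)

-- The outcome condition needs no case of its own in ⋡: following winning
-- moves, its failures reduce to `end` or to noOptions⋡.
mutual
  first⇒⋡ : ∀ {G H} → Dicot G → Binary H → No𝓛 H →
    WinsSecond right G → WinsFirst left H → G ⋡ H
  first⇒⋡ d b n v (cannotMove z) = end z v
  first⇒⋡ d b n v@(reply _ vs) (moveTo j w@(reply _ ws)) = onLeft j (downlink
    (λ i → second⇒⋡ (dicot-option d left i) (binary-option b left j) (No𝓛-option n left j)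
             (vs i) w)
    (λ k → first⇒⋡ d (binary-option (binary-option b left j) right k)
             (No𝓛-option (No𝓛-option n left j) right k) v (ws k)))

  second⇒⋡ : ∀ {G H} → Dicot G → Binary H → No𝓛 H →
    WinsFirst right G → WinsSecond left H → G ⋡ H
  -- The dicot `G` has no Right option, hence no options at all. Excluding `𝓛` turns Left's win of
  -- `H` moving second into a win of `H` for Right moving second, as `noOptions⋡` requires.
  second⇒⋡ {G} {H} d b n (cannotMove z) v with determined left H
  ... | inj₁ w = ⊥-elim (No𝓛⇒¬both n w v)
  ... | inj₂ w = noOptions⋡ (dicot-noOptions d right z) b w
  second⇒⋡ d b n (moveTo i w@(reply _ ws)) v@(reply _ vs) = onRight i (downlink
    (λ k → second⇒⋡ (dicot-option (dicot-option d right i) left k) b n (ws k) v)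
    (λ j → first⇒⋡ (dicot-option d right i) (binary-option b right j)
             (No𝓛-option n right j) w (vs j)))

-- Dominance modulo dicots

_≽_ : Game → Game → Set
G ≽ H = ∀ {X} → Dicot X →
  (WinsFirst left (H ⊕ X) → WinsFirst left (G ⊕ X)) ×
  (WinsSecond left (H ⊕ X) → WinsSecond left (G ⊕ X))

_⊵_ : Game → Game → Set
K ⊵ H = (∃ λ i → option left K i ≽ H) ⊎ (∃ λ j → K ≽ option right H j)

-- In the second alternative Right is imagined to move in `H`: Left then wins moving first, and
-- dominance by `K` transfers that win.
⊵-wins : ∀ {K H X} → K ⊵ H → Dicot X → WinsSecond left (H ⊕ X) → WinsFirst left (K ⊕ X)
⊵-wins {K} {H} {X} (inj₁ (i , ge)) d w = moveˡ K X i (proj₂ (ge d) w)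
⊵-wins {K} {H} {X} (inj₂ (j , ge)) d w = proj₁ (ge d) (replyˡ H X w j)

-- Induction on `X`: moves in `X` are copied between the two sums, and `⊵-wins` handles Left's moves
-- in `H` and Right's moves in `G`. The outcomes of `G` and `H` themselves enter only at `X ≅ 𝟘`,
-- since a nonzero dicot leaves neither player without a move.
≽-intro : ∀ G H → (WinsFirst left H → WinsFirst left G) →
  (WinsSecond left H → WinsSecond left G) →
  (∀ i → option right G i ⊵ H) → (∀ j → G ⊵ option left H j) → G ≽ H
≽-intro G H f g r l {X} (zero e) =
  (λ w → winsFirst-resp G (G ⊕ X) G≅G⊕X (f (winsFirst-resp (H ⊕ X) H H⊕X≅H w))) ,
  (λ w → winsSecond-resp G (G ⊕ X) G≅G⊕X (g (winsSecond-resp (H ⊕ X) H H⊕X≅H w)))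
  where
  H⊕X≅H = ⊕-identityʳ (≅𝟘⇒noOptions e) H
  G≅G⊕X = ≅-sym (G ⊕ X) G (⊕-identityʳ (≅𝟘⇒noOptions e) G)
≽-intro G H f g r l {X} d@(nonzero dᴸ dᴿ) = goFirst , goSecond
  where
  goFirst : WinsFirst left (H ⊕ X) → WinsFirst left (G ⊕ X)
  goFirst w with firstMove H X w
  ... | none _ ()
  ... | inˡ j v = ⊵-wins (l j) d v
  ... | inʳ i v = moveʳ G X i (proj₂ (≽-intro G H f g r l (dᴸ i)) v)

  goSecond : WinsSecond left (H ⊕ X) → WinsSecond left (G ⊕ X)
  goSecond w = reply-⊕ G X zero
    (λ i → ⊵-wins (r i) d w)
    (λ j → proj₁ (≽-intro G H f g r l (dᴿ j)) (replyʳ H X w j))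

-- With `𝓛` excluded, at most one outcome condition of `≽-intro` is not vacuous: Left starting if
-- `H` is `𝓝`, Right starting if `H` is `𝓟`. `first⇒⋡` or `second⇒⋡` converts its failure.
≽-intro′ : ∀ {G H} → Dicot G → Binary H → No𝓛 H →
  (∀ i → option right G i ⊵ H) → (∀ j → G ⊵ option left H j) → (G ⋡ H) ⊎ (G ≽ H)
≽-intro′ {G} {H} d b n r l with determined left H | determined right H
... | inj₁ w | inj₂ v = ⊥-elim (No𝓛⇒¬both n w v)
... | inj₁ w | inj₁ v with determined left G
...   | inj₂ u = inj₁ (first⇒⋡ d b n u w)
...   | inj₁ u = inj₂ (≽-intro G H (λ _ → u) (λ v′ → ⊥-elim (exclusive right H v v′)) r l)
≽-intro′ {G} {H} d b n r l | inj₂ w | inj₁ v =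
  inj₂ (≽-intro G H (λ w′ → ⊥-elim (exclusive left H w′ w))
                    (λ v′ → ⊥-elim (exclusive right H v v′)) r l)
≽-intro′ {G} {H} d b n r l | inj₂ w | inj₂ v with determined right G
... | inj₁ u = inj₁ (second⇒⋡ d b n u v)
... | inj₂ u = inj₂ (≽-intro G H (λ w′ → ⊥-elim (exclusive left H w′ w)) (λ _ → u) r l)

mutual
  -- The dichotomy is constructive because `search` runs through finitely many options; each call of
  -- `link` descends in `G` or in `H`.
  compare : ∀ G H → Dicot G → Binary H → No𝓛 H → (G ⋡ H) ⊎ (G ≽ H)
  compare G@(⟨ gᴸ ∣ gᴿ ⟩) H@(⟨ hᴸ ∣ hᴿ ⟩) d b n
    with search (λ i → link (gᴿ i) H (dicot-option d right i) b n)
       | search (λ j → link G (hᴸ j) d (binary-option b left j) (No𝓛-option n left j))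
  ... | inj₁ (i , dl) | _             = inj₁ (onRight i dl)
  ... | inj₂ _        | inj₁ (j , dl) = inj₁ (onLeft j dl)
  ... | inj₂ r        | inj₂ l        = ≽-intro′ d b n r l

  link : ∀ K H → Dicot K → Binary H → No𝓛 H → (K ⇓ H) ⊎ (K ⊵ H)
  link K@(⟨ kᴸ ∣ kᴿ ⟩) H@(⟨ hᴸ ∣ hᴿ ⟩) d b n
    with search (λ i → swap (compare (kᴸ i) H (dicot-option d left i) b n))
       | search (λ j → swap (compare K (hᴿ j) d (binary-option b right j) (No𝓛-option n right j)))
  ... | inj₁ ge | _       = inj₂ (inj₁ ge)
  ... | inj₂ _  | inj₁ ge = inj₂ (inj₂ ge)
  ... | inj₂ f  | inj₂ g  = inj₁ (downlink f g)

-- Separating games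

Separator₁ : (Game → Set) → Game → Set
Separator₁ P H = ∃ λ Z → 𝓓𝓑 Z × WinsFirst left (H ⊕ Z) ×
  (∀ {G} → P G → WinsSecond right (G ⊕ Z))

Separator₂ : (Game → Set) → Game → Set
Separator₂ P H = ∃ λ Z → 𝓓𝓑 Z × WinsSecond left (H ⊕ Z) ×
  (∀ {G} → P G → WinsFirst right (G ⊕ Z))

-- Left opens with `T` in `H`. In `G`, opening with `T` loses, and any other opening is a move in
-- `G`, which Right answers with `rightWinning n`; this needs a common height bound.
separator₂⇒₁ : ∀ {P H} n → (∀ {G} → P G → Dicot≤ n G) → Separator₂ P H → Separator₁ P H
separator₂⇒₁ {P} {H} n bound (T , T-𝓓𝓑 , wᴸ , wᴿ) =
  T ∥ rightWinning n , ∥-𝓓𝓑 T-𝓓𝓑 (rightWinning-𝓓𝓑 n) ,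
  moveʳ H (T ∥ rightWinning n) zero wᴸ ,
  λ {G} pG → reply-⊕ G (T ∥ rightWinning n) zero
    (λ i → moveʳ (option left G i) (T ∥ rightWinning n) zero
             (rightWinning-second n (Dicot≤-option (bound pG) left i)))
    (λ _ → wᴿ pG)

-- Right opens with `Z` in `G`. In `H` that opening loses, and a Right move in `H` is answered with
-- `A`, taken from `leftWinning`.
separator₁⇒₂ : ∀ {P H} → Binary H → Separator₁ P H → Separator₂ P H
separator₁⇒₂ {P} {H} b (Z , Z-𝓓𝓑 , wᴸ , wᴿ) =
  let A , A-𝓓𝓑 , A-wins = afterRight b
  in A ∥ Z , ∥-𝓓𝓑 A-𝓓𝓑 Z-𝓓𝓑 ,
     reply-⊕ H (A ∥ Z) zero (λ j → moveʳ (option right H j) (A ∥ Z) zero (A-wins j)) (λ _ → wᴸ) ,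
     λ {G} pG → moveʳ G (A ∥ Z) zero (wᴿ pG)
  where
  afterRight : ∀ {H} → Binary H →
    ∃ λ A → 𝓓𝓑 A × (∀ j → WinsSecond left (option right H j ⊕ A))
  afterRight (binary {r = zero} _ _ _ _) = 𝟘 , 𝟘-𝓓𝓑 , λ ()
  afterRight (binary {r = suc r} _ e _ bᴿ) =
    let A , A-𝓓𝓑 , w = leftWinning (bᴿ zero)
    in A , A-𝓓𝓑 , λ j → winsSecond-⊕-resp A (e zero j) w

Fails : ℕ → Game → Game → Set
Fails n H G = Dicot≤ n G × G ⋡ H

-- `Y` is meant as the Left option of some `Y ∥ Z`: Left answers Right's moves in `H` with it, but
-- loses by choosing it in a sum with `K`.
Response : ℕ → Game → Set
Response n H = ∃ λ Y → 𝓓𝓑 Y × (∀ j → WinsSecond left (option right H j ⊕ Y)) ×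
  (∀ {K} → Dicot≤ n K → (∀ j → K ⋡ option right H j) → WinsFirst right (K ⊕ Y))

response : ∀ {n H} → Binary H →
  (∀ j → Separator₂ (Fails n (option right H j)) (option right H j)) → Response n H
response {n} (binary {r = zero} _ _ _ _) _ =
  -- Right moves first here, stepping down to `rightWinning n`; hence `suc n`.
  rightWinning (suc n) , rightWinning-𝓓𝓑 (suc n) , (λ ()) , λ d _ → rightWinning-first n d
response (binary {r = suc r} _ e _ _) s =
  let Y , Y-𝓓𝓑 , wᴸ , wᴿ = s zero
  in Y , Y-𝓓𝓑 , (λ j → winsSecond-⊕-resp Y (e zero j) wᴸ) , λ d f → wᴿ (d , f zero)

-- With `response-winsSecond`, this makes `Y ∥ Z` a witness of downlinking: the single Right option
-- `Z` answers every Left move in `K`, and `Y` is a losing choice for Left.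
⇓-winsSecond : ∀ {n K Z} H → ((Y , _) : Response n H) → Dicot≤ n K →
  (∀ i → WinsSecond right (option left K i ⊕ Z)) → (∀ j → K ⋡ option right H j) →
  WinsSecond right (K ⊕ (Y ∥ Z))
⇓-winsSecond {K = K} {Z} _ (Y , _ , _ , wᴿ) d f g = reply-⊕ K (Y ∥ Z) zero
  (λ i → moveʳ (option left K i) (Y ∥ Z) zero (f i))
  (λ _ → wᴿ d g)

response-winsSecond : ∀ {n H Z} → ((Y , _) : Response n H) →
  WinsFirst left (H ⊕ Z) → WinsSecond left (H ⊕ (Y ∥ Z))
response-winsSecond {H = H} {Z} (Y , _ , wᴸ , _) w = reply-⊕ H (Y ∥ Z) zero
  (λ j → moveʳ (option right H j) (Y ∥ Z) zero (wᴸ j))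
  (λ _ → w)

-- Failures not due to a Right option of G: Z can be given directly for these,
-- and separate-suc then adds the others one height at a time.
NotOnRight : Game → Game → Set
NotOnRight G H = (#options left H ≡ 0 × WinsSecond right G) ⊎ (∃ λ j → G ⇓ option left H j)

FailsBelow : ℕ → ℕ → Game → Game → Set
FailsBelow n k H G = Dicot≤ n G × (NotOnRight G H ⊎ (Dicot≤ k G × G ⋡ H))

-- In `G ⊕ (Y ∥ Z)` Right opens with `Z` if the failure is not on the right, and otherwise with the
-- downlinked Right option of `G`. The result is a `Separator₂`, turned back by `separator₂⇒₁`.
separate-suc : ∀ {n H} k → Response n H →
  Separator₁ (FailsBelow n k H) H → Separator₁ (FailsBelow n (suc k) H) H
separate-suc {n} {H} k ρ@(Y , Y-𝓓𝓑 , _) (Z , Z-𝓓𝓑 , wᴸ , wᴿ) = separator₂⇒₁ n proj₁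
  (Y ∥ Z , ∥-𝓓𝓑 Y-𝓓𝓑 Z-𝓓𝓑 , response-winsSecond {Z = Z} ρ wᴸ , rightWins)
  where
  toZ : ∀ {G} → Dicot≤ n G → NotOnRight G H → WinsFirst right (G ⊕ (Y ∥ Z))
  toZ {G} d x = moveʳ G (Y ∥ Z) zero (wᴿ (d , inj₁ x))

  rightWins : ∀ {G} → FailsBelow n (suc k) H G → WinsFirst right (G ⊕ (Y ∥ Z))
  rightWins (d , inj₁ x) = toZ d x
  rightWins (d , inj₂ (_ , end z w)) = toZ d (inj₁ (z , w))
  rightWins (d , inj₂ (_ , onLeft j dl)) = toZ d (inj₂ (j , dl))
  rightWins {G} (d , inj₂ (d′ , onRight i (downlink f g))) = moveˡ G (Y ∥ Z) i
    (⇓-winsSecond H ρ dⁿ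
      -- Left's move after Right's move in `G` yields a game of height at most `k` that still fails
      -- against `H`, so `Z` already handles it.
      (λ a → wᴿ (Dicot≤-option dⁿ left a ,
                 inj₂ (Dicot≤-option (Dicot≤-option⁻ d′ right i) left a , f a)))
      g)
    where dⁿ = Dicot≤-option d right i

mutual
  -- The outer recursion is on `H`. An `onRight` failure returns to the same `H` with a lower game,
  -- hence the inner iteration; `n` rounds reach every height allowed by `Fails n`.
  separate₁ : ∀ n {H} → Binary H → Separator₁ (Fails n H) H
  separate₁ n {H} b =
    let Z , Z-𝓓𝓑 , wᴸ , wᴿ = iterate n
    in Z , Z-𝓓𝓑 , wᴸ , λ { (d , f) → wᴿ (d , inj₂ (d , f)) }
    where
    iterate : ∀ k → Separator₁ (FailsBelow n k H) H
    iterate zero =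
      let Z , Z-𝓓𝓑 , wᴸ , wᴿ = separateNotOnRight n b in Z , Z-𝓓𝓑 , wᴸ , λ where
        (d , inj₁ x)                      → wᴿ (d , x)
        (d , inj₂ (_ , end z w))          → wᴿ (d , inj₁ (z , w))
        (d , inj₂ (_ , onLeft j dl))      → wᴿ (d , inj₂ (j , dl))
        (d , inj₂ (zero z , onRight i _)) → noOption (z right) i
    iterate (suc k) = separate-suc k (respond n b) (iterate k)

  separateNotOnRight : ∀ n {H} → Binary H →
    Separator₁ (λ G → Dicot≤ n G × NotOnRight G H) H
  separateNotOnRight n {H} (binary {l = zero} _ _ _ _) =
    -- `H` has no Left option, so in `H ⊕ 𝟘` Left is stuck and wins, while `end` records Right's win
    -- in `G`.
    𝟘 , 𝟘-𝓓𝓑 , cannotMove-⊕ H 𝟘 refl refl , λ where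
      (_ , inj₁ (_ , w)) → winsSecond-resp _ _
        (≅-sym (_ ⊕ 𝟘) _ (⊕-identityʳ (≅𝟘⇒noOptions (≅-refl 𝟘)) _)) w
      (_ , inj₂ (() , _))
  separateNotOnRight n {H} (binary {l = suc l} {gᴸ = hᴸ} e _ bᴸ _) =
    -- `H` has a Left option, unique up to `≅`, which rules out `end`. Left opens by moving to it,
    -- and the downlink to it gives Right the win in `G`.
    let ρ@(Y , Y-𝓓𝓑 , _) = respond n (bᴸ zero)
        Z , Z-𝓓𝓑 , wᴸ , wᴿ = separate₁ n (bᴸ zero)
    in Y ∥ Z , ∥-𝓓𝓑 Y-𝓓𝓑 Z-𝓓𝓑 ,
       moveˡ H (Y ∥ Z) zero (response-winsSecond {Z = Z} ρ wᴸ) , λ where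
         (_ , inj₁ (() , _))
         (d , inj₂ (j , dl)) → ⇓⇒winsSecond (hᴸ zero) ρ wᴿ d (⇓-respʳ (hᴸ j) (hᴸ zero) (e j zero) dl)
    where
    ⇓⇒winsSecond : ∀ {Z} J → ((Y , _) : Response n J) →
      (∀ {G} → Fails n J G → WinsSecond right (G ⊕ Z)) →
      ∀ {G} → Dicot≤ n G → G ⇓ J → WinsSecond right (G ⊕ (Y ∥ Z))
    ⇓⇒winsSecond J ρ wᴿ d (downlink f g) =
      ⇓-winsSecond J ρ d (λ i → wᴿ (Dicot≤-option d left i , f i)) g

  respond : ∀ n {H} → Binary H → Response n H
  respond n b@(binary _ _ _ bᴿ) = response b λ j → separator₁⇒₂ (bᴿ j) (separate₁ n (bᴿ j))

-- Comparison modulo dicots and modulo binary dicots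

⋡⇒¬≥⁻ : ∀ {G H} → Dicot G → Binary H → G ⋡ H → ¬ (G ≥⁻[ 𝓓𝓑 ] H)
⋡⇒¬≥⁻ {G} {H} d b f ge =
  let n , d≤ = dicot⇒Dicot≤ d
      Z , Z-𝓓𝓑 , wᴸ , wᴿ = separate₁ n b
  in exclusive left (G ⊕ Z) (≤ᵒ⇒winsFirst (H ⊕ Z) (G ⊕ Z) (ge Z Z-𝓓𝓑) wᴸ) (wᴿ (d≤ , f))

≽⇒≥⁻ : ∀ {G H} → G ≽ H → G ≥⁻[ 𝓓 ] H
≽⇒≥⁻ {G} {H} ge X d = ≤ᵒ-intro (H ⊕ X) (G ⊕ X) (proj₁ (ge d)) (proj₂ (ge d))

theorem3p17 : (G H : Game) → Dicot G → Binary H →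
    (∀ K → K FollowerOf H → o⁻ K ≢ 𝓛) →
    (G ≥⁻[ 𝓓 ] H) ⇔ (G ≥⁻[ 𝓓𝓑 ] H)
theorem3p17 G H d b n = mk⇔ (λ ge X (_ , dX) → ge X dX) from
  where
  from : G ≥⁻[ 𝓓𝓑 ] H → G ≥⁻[ 𝓓 ] H
  from ge with compare G H d b n
  ... | inj₁ f   = ⊥-elim (⋡⇒¬≥⁻ d b f ge)
  ... | inj₂ dom = ≽⇒≥⁻ dom
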